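{- Let $L$ be a Fomin lattice with minimum element $\hat{0}$, value set $V=\mathbb{Z}$, differential degree $r>0$ and weighting $w$, and suppose that for every covering $x\lessdot y$ with $w(x\lessdot y)<0$ there exist $z,v\in L$ with $z\lessdot v\le x$ and $w(z\lessdot v)=0$. Then the truncation $L_/$ (with differential degree $r$ and weighting the restriction of $w$) is a Fomin lattice with minimum element $\hat{0}$ whose weighting is positive.
   Context: A Fomin lattice consists of: a lattice $L$ that is modular, locally finite, and in which every element has finitely many upper covers and finitely many lower covers; a module $V$ (the set of values) over a unital ring; an element $r\in V$ (the differential degree); and a function $w$ assigning to every covering $x\lessdot y$ of $L$ a value in $V$, such that (a) for all $x\in L$, $\sum_{y\lessdot x} w(y\lessdot x)+r=\sum_{x\lessdot z}w(x\lessdot z)$, and (b) $w$ is projective-constant: whenever $x\vee y$ covers both $x$ and $y$ and $x\wedge y$ is covered by both, then $w(x\wedge y\lessdot x)=w(y\lessdot x\vee y)$ and $w(x\wedge y\lessdot y)=w(x\lessdot x\vee y)$. A weighting is positive if $V=\mathbb{Z}$, all its values are positive integers and $r>0$. Let $S$ be the set of coverings with $w$-value $0$; $x\sim y$ means no covering in a maximal chain from $x\wedge y$ to $x\vee y$ lies in $S$ (independent of the chain). The truncation $L_/$ is $\{x\in L: x\sim\hat{0}\}$. -}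

module Defs where

open import Level using (Level; _⊔_)
open import Data.Integer using (ℤ; _+_; _<_; +_)
open import Data.List using (List; []; _∷_; foldr; map)
open import Data.List.Relation.Unary.Any using (Any)
open import Data.List.Relation.Unary.AllPairs using (AllPairs)
open import Data.Product using (Σ; ∃; _×_; proj₁)
open import Relation.Nullary using (¬_)
open import Relation.Binary.Core using (Rel)
open import Relation.Binary.PropositionalEquality using (_≡_)
open import Relation.Binary.Lattice.Structures using (IsLattice)
open import Algebra.Core using (Op₂)

sumℤ : List ℤ → ℤ
sumℤ = foldr _+_ (+ 0)

module Order {a ℓ₁ ℓ₂ : Level} {A : Set a} (_≈_ : Rel A ℓ₁) (_≤_ : Rel A ℓ₂) where

  _≺_ : Rel A (ℓ₁ ⊔ ℓ₂)
  x ≺ y = (x ≤ y) × ¬ (x ≈ y)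

  _⋖_ : Rel A (a ⊔ ℓ₁ ⊔ ℓ₂)
  x ⋖ y = (x ≺ y) × (∀ z → x ≺ z → z ≺ y → Data.Empty.⊥)
    where import Data.Empty

  _∈≈_ : A → List A → Set (a ⊔ ℓ₁)
  y ∈≈ l = Any (y ≈_) l

  IsUpperCoverList : A → List A → Set (a ⊔ ℓ₁ ⊔ ℓ₂)
  IsUpperCoverList x l =
    AllPairs (λ u v → ¬ (u ≈ v)) l × (∀ y → (y ∈≈ l → x ⋖ y) × (x ⋖ y → y ∈≈ l))

  IsLowerCoverList : A → List A → Set (a ⊔ ℓ₁ ⊔ ℓ₂)
  IsLowerCoverList x l =
    AllPairs (λ u v → ¬ (u ≈ v)) l × (∀ y → (y ∈≈ l → y ⋖ x) × (y ⋖ x → y ∈≈ l))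

  Minimum' : A → Set (a ⊔ ℓ₂)
  Minimum' m = ∀ x → m ≤ x

-- A Fomin lattice with values in ℤ, differential degree r and weighting w
-- (w is given on all pairs but only its values on coverings matter).
record IsFominLattice {a ℓ₁ ℓ₂ : Level} {A : Set a} (_≈_ : Rel A ℓ₁) (_≤_ : Rel A ℓ₂)
                      (r : ℤ) (w : A → A → ℤ) : Set (a ⊔ ℓ₁ ⊔ ℓ₂) where
  open Order _≈_ _≤_
  field
    _∨_ : Op₂ A
    _∧_ : Op₂ A
    isLattice : IsLattice _≈_ _≤_ _∨_ _∧_
    modular : ∀ x y z → x ≤ z → (x ∨ (y ∧ z)) ≈ ((x ∨ y) ∧ z)
    locallyFinite : ∀ x y → ∃ λ (l : List A) → ∀ z → x ≤ z → z ≤ y → z ∈≈ l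
    finiteUpperCovers : ∀ x → ∃ λ (l : List A) → IsUpperCoverList x l
    finiteLowerCovers : ∀ x → ∃ λ (l : List A) → IsLowerCoverList x l
    w-resp : ∀ {x x′ y y′} → x ≈ x′ → y ≈ y′ → w x y ≡ w x′ y′
    differential : ∀ x (lo up : List A) → IsLowerCoverList x lo → IsUpperCoverList x up →
                   sumℤ (map (λ y → w y x) lo) + r ≡ sumℤ (map (λ z → w x z) up)
    projective : ∀ x y → x ⋖ (x ∨ y) → y ⋖ (x ∨ y) → (x ∧ y) ⋖ x → (x ∧ y) ⋖ y →
                 (w (x ∧ y) x ≡ w y (x ∨ y)) × (w (x ∧ y) y ≡ w x (x ∨ y))

IsPositive : ∀ {a ℓ₁ ℓ₂} {A : Set a} (_≈_ : Rel A ℓ₁) (_≤_ : Rel A ℓ₂) (r : ℤ) (w : A → A → ℤ) →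
             Set (a ⊔ ℓ₁ ⊔ ℓ₂)
IsPositive _≈_ _≤_ r w = (+ 0 < r) × (∀ x y → x ⋖ y → + 0 < w x y)
  where open Order _≈_ _≤_

module Truncation {a ℓ₁ ℓ₂ : Level} {A : Set a} {_≈_ : Rel A ℓ₁} {_≤_ : Rel A ℓ₂}
                  {r : ℤ} {w : A → A → ℤ} (F : IsFominLattice _≈_ _≤_ r w) where
  open Order _≈_ _≤_
  open IsFominLattice F

  data ZeroFreeChain : A → A → Set (a ⊔ ℓ₁ ⊔ ℓ₂) where
    done : ∀ {x y} → x ≈ y → ZeroFreeChain x y
    step : ∀ {x y z} → x ⋖ y → ¬ (w x y ≡ + 0) → ZeroFreeChain y z → ZeroFreeChain x z

  _∼_ : A → A → Set (a ⊔ ℓ₁ ⊔ ℓ₂)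
  x ∼ y = ZeroFreeChain (x ∧ y) (x ∨ y)

  Carrier/ : A → Set (a ⊔ ℓ₁ ⊔ ℓ₂)
  Carrier/ 0̂ = Σ A (λ x → x ∼ 0̂)

  _≈/_ : ∀ {0̂} → Rel (Carrier/ 0̂) ℓ₁
  p ≈/ q = proj₁ p ≈ proj₁ q

  _≤/_ : ∀ {0̂} → Rel (Carrier/ 0̂) ℓ₂
  p ≤/ q = proj₁ p ≤ proj₁ q

  w/ : ∀ {0̂} → Carrier/ 0̂ → Carrier/ 0̂ → ℤ
  w/ p q = w (proj₁ p) (proj₁ q)

{-# OPTIONS --safe #-}

-- If p is covered by distinct q and s, modularity makes q and s both covered by
-- q ∨ s, and projectivity transports the weights across this square.  Sliding a
-- covering x ⋖ q along a chain from x to t therefore either meets a step of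
-- the chain, so that w x q is the weight of that step and q ≤ t, or arrives at
-- t ⋖ q ∨ t with the same weight.  Hence the truncation is a sublattice closed
-- downwards, no covering below one of its elements has weight 0, and a covering
-- that leaves it at the top has weight 0 and does not contribute to the
-- differential identity.
--
-- No decidability of ≈ is given, but two elements of one cover list are equal or
-- distinct; as r ≢ 0 every element has a cover, and this makes ≈ stable where needed.
module Submission where

open import Defs
open import Level using (Level; _⊔_)
open import Data.Integer using (ℤ; _+_; _<_; +_; _≟_)
import Data.Integer.Properties as ℤ
open import Data.List using (List; []; _∷_; _++_; map; filter; length)
open import Data.List.Properties using (length-removeAt′; map-++; map-∘)
open import Data.List.Relation.Unary.All using (All; []; _∷_)
import Data.List.Relation.Unary.All as All
import Data.List.Relation.Unary.All.Properties as All
open import Data.List.Relation.Unary.AllPairs using (AllPairs; []; _∷_)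
import Data.List.Relation.Unary.AllPairs.Properties as AllPairs
open import Data.List.Relation.Unary.Any using (Any; here; there; _─_; index)
import Data.List.Relation.Unary.Any as Any
import Data.List.Relation.Unary.Any.Properties as Any
import Data.List.Membership.Setoid.Properties as Membership
import Data.Nat as ℕ
import Data.Nat.Properties as ℕ
open import Data.Product using (Σ; ∃; _×_; _,_; proj₁; proj₂)
open import Data.Sum using (_⊎_; inj₁; inj₂)
open import Function using (_∘_)
open import Induction.WellFounded using (Acc; acc)
open import Relation.Binary.Bundles using (Setoid)
open import Relation.Binary.Core using (Rel)
open import Relation.Binary.Definitions using (tri<; tri≈; tri>)
open import Relation.Binary.Lattice using (Lattice; module IsLattice)
import Relation.Binary.Construct.On as On
import Relation.Binary.Lattice.Properties.JoinSemilattice as JoinProperties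
import Relation.Binary.Lattice.Properties.MeetSemilattice as MeetProperties
open import Relation.Binary.PropositionalEquality using (_≡_; refl; sym; trans; cong; cong₂; subst; module ≡-Reasoning)
open import Relation.Nullary using (¬_; yes; no; contradiction; ¬?)
open import Relation.Unary using (Pred)

-- Lists of subtype elements and integer sums.

lift-list : ∀ {a p} {A : Set a} {P : Pred A p} {xs : List A} → All P xs →
            ∃ λ (ys : List (Σ A P)) → map proj₁ ys ≡ xs
lift-list []         = [] , refl
lift-list (px ∷ pxs) = let ys , eq = lift-list pxs in (_ , px) ∷ ys , cong (_ ∷_) eq

sumℤ-++ : ∀ xs ys → sumℤ (xs ++ ys) ≡ sumℤ xs + sumℤ ys
sumℤ-++ []       ys = sym (ℤ.+-identityˡ _)
sumℤ-++ (x ∷ xs) ys = trans (cong (_+_ x) (sumℤ-++ xs ys)) (sym (ℤ.+-assoc x _ _))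

sumℤ-zeros : ∀ {a} {A : Set a} {f : A → ℤ} {xs : List A} →
             All (λ x → f x ≡ + 0) xs → sumℤ (map f xs) ≡ + 0
sumℤ-zeros []         = refl
sumℤ-zeros (eq ∷ eqs) = cong₂ _+_ eq (sumℤ-zeros eqs)

-- Finite lists up to setoid equality.

module _ {a ℓ} (S : Setoid a ℓ) where
  open Setoid S renaming (Carrier to A; refl to ≈-refl; sym to ≈-sym; trans to ≈-trans)
  open import Data.List.Membership.Setoid S using (_∈_)

  ∈-─ : ∀ {x y} {xs : List A} (x∈xs : x ∈ xs) → y ∈ xs → ¬ (y ≈ x) → y ∈ (xs ─ x∈xs)
  ∈-─ (here x≈u) (here y≈u) y≉x = contradiction (≈-trans y≈u (≈-sym x≈u)) y≉x
  ∈-─ (here _)   (there q)  _   = q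
  ∈-─ {xs = _ ∷ _ ∷ _} (there _) (here y≈u) _   = here y≈u
  ∈-─ {xs = _ ∷ _ ∷ _} (there p) (there q)  y≉x = there (∈-─ p q y≉x)

  -- Removing x from the list leaves all strict predecessors of x listed.
  finite⇒Acc : ∀ {ℓ′} {_⊏_ : Rel A ℓ′} → (∀ {x y z} → x ⊏ y → y ⊏ z → x ⊏ z) →
               (∀ {x y} → x ⊏ y → ¬ (x ≈ y)) →
               ∀ {x} (xs : List A) → x ∈ xs → (∀ y → y ⊏ x → y ∈ xs) → Acc _⊏_ x
  finite⇒Acc {_⊏_ = _⊏_} ⊏-trans ⊏-irrefl xs = go _ xs ℕ.≤-refl
    where
    go : ∀ n {x} (xs : List A) → length xs ℕ.≤ n → x ∈ xs → (∀ y → y ⊏ x → y ∈ xs) → Acc _⊏_ x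
    go ℕ.zero    []         _     ()
    go (ℕ.suc n) xs len x∈xs below = acc λ {y} y⊏x →
      go n (xs ─ x∈xs)
        (ℕ.≤-pred (ℕ.≤-trans (ℕ.≤-reflexive (sym (length-removeAt′ xs (index x∈xs)))) len))
        (∈-─ x∈xs (below y y⊏x) (⊏-irrefl y⊏x))
        (λ z z⊏y → let z⊏x = ⊏-trans z⊏y y⊏x in ∈-─ x∈xs (below z z⊏x) (⊏-irrefl z⊏x))

  -- Positions decide: members matched at the same position are equal, and members matched at
  -- different positions are distinct because the entries are.
  distinct⇒≈-dec : ∀ {x y} {xs : List A} → AllPairs (λ u v → ¬ (u ≈ v)) xs →
                   x ∈ xs → y ∈ xs → x ≈ y ⊎ ¬ (x ≈ y)
  distinct⇒≈-dec _          (here p)  (here q)  = inj₁ (≈-trans p (≈-sym q))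
  distinct⇒≈-dec (h ∷ _)    (here p)  (there q) = inj₂ λ x≈y →
    All.lookupWith (λ u≉v y≈v → u≉v (≈-trans (≈-sym p) (≈-trans x≈y y≈v))) h q
  distinct⇒≈-dec (h ∷ _)    (there p) (here q)  = inj₂ λ x≈y →
    All.lookupWith (λ u≉v x≈v → u≉v (≈-trans (≈-sym q) (≈-trans (≈-sym x≈y) x≈v))) h p
  distinct⇒≈-dec (_ ∷ hs)   (there p) (there q) = distinct⇒≈-dec hs p q

  All-members : ∀ {p} {P : Pred A p} (xs : List A) → (∀ y → y ∈ xs → P y) → All P xs
  All-members []       _ = []
  All-members (x ∷ xs) h = h x (here ≈-refl) ∷ All-members xs (λ y → h y ∘ there)

-- Coverings and modular squares in a Fomin lattice.

module Fomin {a ℓ₁ ℓ₂ : Level} {A : Set a} {_≈_ : Rel A ℓ₁} {_≤_ : Rel A ℓ₂}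
             {r : ℤ} {w : A → A → ℤ} (F : IsFominLattice _≈_ _≤_ r w) where
  open Order _≈_ _≤_ public
  open IsFominLattice F public
  open Truncation F public
  open IsLattice isLattice public
    using (isPartialOrder; isEquivalence; antisym; x≤x∨y; y≤x∨y; ∨-least; x∧y≤x; x∧y≤y; ∧-greatest)
    renaming (refl to ≤-refl; trans to ≤-trans; reflexive to ≤-reflexive;
              module Eq to ≈)

  lattice : Lattice a ℓ₁ ℓ₂
  lattice = record { isLattice = isLattice }

  open JoinProperties (Lattice.joinSemilattice lattice) public
    using (∨-cong; ∨-comm; ∨-assoc; ∨-monotonic; x≤y⇒x∨y≈y)
  open MeetProperties (Lattice.meetSemilattice lattice) public
    using (∧-cong; ∧-comm; y≤x⇒x∧y≈y)

  ≈-setoid : Setoid a ℓ₁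
  ≈-setoid = record { isEquivalence = isEquivalence }

  ≺-trans : ∀ {x y z} → x ≺ y → y ≺ z → x ≺ z
  ≺-trans (x≤y , x≉y) (y≤z , _) = ≤-trans x≤y y≤z ,
    λ x≈z → x≉y (antisym x≤y (≤-trans y≤z (≤-reflexive (≈.sym x≈z))))

  ≺-resp : ∀ {x x′ y y′} → x ≈ x′ → y ≈ y′ → x ≺ y → x′ ≺ y′
  ≺-resp x≈x′ y≈y′ (x≤y , x≉y) =
    ≤-trans (≤-reflexive (≈.sym x≈x′)) (≤-trans x≤y (≤-reflexive y≈y′)) ,
    λ x′≈y′ → x≉y (≈.trans x≈x′ (≈.trans x′≈y′ (≈.sym y≈y′)))

  ⋖-resp : ∀ {x x′ y y′} → x ≈ x′ → y ≈ y′ → x ⋖ y → x′ ⋖ y′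
  ⋖-resp x≈x′ y≈y′ (x≺y , empty) = ≺-resp x≈x′ y≈y′ x≺y ,
    λ z x′≺z z≺y′ → empty z (≺-resp (≈.sym x≈x′) ≈.refl x′≺z) (≺-resp ≈.refl (≈.sym y≈y′) z≺y′)

  ⋖⇒≤ : ∀ {x y} → x ⋖ y → x ≤ y
  ⋖⇒≤ = proj₁ ∘ proj₁

  upper-covers-≈-dec : ∀ {x y z} → x ⋖ y → x ⋖ z → y ≈ z ⊎ ¬ (y ≈ z)
  upper-covers-≈-dec {x} {y} {z} x⋖y x⋖z =
    let _ , distinct , covers = finiteUpperCovers x
    in distinct⇒≈-dec ≈-setoid distinct (proj₂ (covers y) x⋖y) (proj₂ (covers z) x⋖z)

  lower-covers-≈-dec : ∀ {x y z} → y ⋖ x → z ⋖ x → y ≈ z ⊎ ¬ (y ≈ z)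
  lower-covers-≈-dec {x} {y} {z} y⋖x z⋖x =
    let _ , distinct , covers = finiteLowerCovers x
    in distinct⇒≈-dec ≈-setoid distinct (proj₂ (covers y) y⋖x) (proj₂ (covers z) z⋖x)

  -- Given `x′ ≤ y`, being covered by `y` is a negative statement, so it passes from `x` to `x′`
  -- through the double negation. Two lower covers of `y` can then be compared.
  ⋖-stable : ∀ {x x′ y} → x ⋖ y → x′ ≤ y → ¬ ¬ (x ≈ x′) → x ≈ x′
  ⋖-stable {x} {x′} {y} x⋖y@((_ , x≉y) , empty) x′≤y ¬x≉x′ with lower-covers-≈-dec x⋖y x′⋖y
    where
    x′⋖y : x′ ⋖ y
    x′⋖y = (x′≤y , λ x′≈y → ¬x≉x′ λ x≈x′ → x≉y (≈.trans x≈x′ x′≈y)) ,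
           λ z x′≺z z≺y → ¬x≉x′ λ x≈x′ → empty z (≺-resp (≈.sym x≈x′) ≈.refl x′≺z) z≺y
  ... | inj₁ x≈x′ = x≈x′
  ... | inj₂ x≉x′ = contradiction x≉x′ ¬x≉x′

  ⋖-distinct⇒≰ : ∀ {p q s} → p ⋖ q → p ⋖ s → ¬ (q ≈ s) → ¬ (q ≤ s)
  ⋖-distinct⇒≰ (p≺q , _) (_ , empty) q≉s q≤s = empty _ p≺q (q≤s , q≉s)

  -- An element `t` strictly between `s` and `q ∨ s` would put `q ∧ t` strictly between `p` and `q`:
  -- if `q ∧ t` were `p`, modularity would give `t ≈ s`, and if it were `q`, then `t` would be the
  -- whole join.
  ⋖-distinct-∨ : ∀ {p q s} → p ⋖ q → p ⋖ s → ¬ (q ≈ s) → s ⋖ (q ∨ s)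
  ⋖-distinct-∨ {p} {q} {s} p⋖q@((p≤q , _) , empty) p⋖s q≉s =
    (y≤x∨y q s , λ s≈q∨s → q≰s (≤-trans (x≤x∨y q s) (≤-reflexive (≈.sym s≈q∨s)))) , no-between
    where
    q≰s = ⋖-distinct⇒≰ p⋖q p⋖s q≉s
    p≤s = ⋖⇒≤ p⋖s
    no-between : ∀ t → s ≺ t → t ≺ (q ∨ s) → _
    no-between t (s≤t , s≉t) (t≤q∨s , t≉q∨s) =
      empty (q ∧ t)
        ( ∧-greatest p≤q (≤-trans p≤s s≤t)
        , λ p≈q∧t → s≉t (antisym s≤t (≤-trans t≤s∨q∧t
            (∨-least ≤-refl (≤-trans (≤-reflexive (≈.sym p≈q∧t)) p≤s)))))
        ( x∧y≤x q t
        , λ q∧t≈q → t≉q∨s (antisym t≤q∨s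
            (∨-least (≤-trans (≤-reflexive (≈.sym q∧t≈q)) (x∧y≤y q t)) s≤t)))
      where
      t≤s∨q∧t : t ≤ (s ∨ (q ∧ t))
      t≤s∨q∧t = ≤-trans (∧-greatest (≤-trans t≤q∨s (≤-reflexive (∨-comm q s))) ≤-refl)
                        (≤-reflexive (≈.sym (modular s q t s≤t)))

  -- `q ∧ s` lies between `p` and `q` and is not `q`, so the covering leaves only `p`, up to a
  -- double negation that `⋖-stable` removes.
  ⋖-distinct-∧ : ∀ {p q s} → p ⋖ q → p ⋖ s → ¬ (q ≈ s) → p ≈ (q ∧ s)
  ⋖-distinct-∧ {p} {q} {s} p⋖q@(_ , empty) p⋖s q≉s =
    ⋖-stable p⋖q (x∧y≤x q s) λ p≉q∧s →
      empty (q ∧ s) (∧-greatest (⋖⇒≤ p⋖q) (⋖⇒≤ p⋖s) , p≉q∧s)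
        (x∧y≤x q s , λ q∧s≈q → ⋖-distinct⇒≰ p⋖q p⋖s q≉s
          (≤-trans (≤-reflexive (≈.sym q∧s≈q)) (x∧y≤y q s)))

  ⋖-distinct-w : ∀ {p q s} → p ⋖ q → p ⋖ s → ¬ (q ≈ s) → w p q ≡ w s (q ∨ s)
  ⋖-distinct-w {p} {q} {s} p⋖q p⋖s q≉s =
    trans (w-resp p≈q∧s ≈.refl)
      (proj₁ (projective q s
        (⋖-resp ≈.refl (∨-comm s q) (⋖-distinct-∨ p⋖s p⋖q (q≉s ∘ ≈.sym)))
        (⋖-distinct-∨ p⋖q p⋖s q≉s)
        (⋖-resp p≈q∧s ≈.refl p⋖q) (⋖-resp p≈q∧s ≈.refl p⋖s)))
    where p≈q∧s = ⋖-distinct-∧ p⋖q p⋖s q≉s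

  -- Zero-free chains and sliding coverings along them.

  chain⇒≤ : ∀ {x y} → ZeroFreeChain x y → x ≤ y
  chain⇒≤ (done x≈y)     = ≤-reflexive x≈y
  chain⇒≤ (step x⋖y _ c) = ≤-trans (⋖⇒≤ x⋖y) (chain⇒≤ c)

  chain-respˡ : ∀ {x x′ y} → x ≈ x′ → ZeroFreeChain x y → ZeroFreeChain x′ y
  chain-respˡ x≈x′ (done x≈y)      = done (≈.trans (≈.sym x≈x′) x≈y)
  chain-respˡ x≈x′ (step x⋖y w≢0 c) =
    step (⋖-resp x≈x′ ≈.refl x⋖y) (w≢0 ∘ trans (w-resp x≈x′ ≈.refl)) c

  chain-trans : ∀ {x y z} → ZeroFreeChain x y → ZeroFreeChain y z → ZeroFreeChain x z
  chain-trans (done x≈y)       d = chain-respˡ (≈.sym x≈y) d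
  chain-trans (step x⋖y w≢0 c) d = step x⋖y w≢0 (chain-trans c d)

  chain-respʳ : ∀ {x y y′} → y ≈ y′ → ZeroFreeChain x y → ZeroFreeChain x y′
  chain-respʳ y≈y′ c = chain-trans c (done y≈y′)

  -- Induction on the chain. If its first step goes to a cover `s` distinct from `q`, the covering
  -- moves to `s ⋖ (q ∨ s)`, while the opposite side `q ⋖ (q ∨ s)` inherits the nonzero weight of
  -- `x ⋖ s`. These opposite sides form the zero-free chain out of `q`.
  slide : ∀ {x q t} → x ⋖ q → ZeroFreeChain x t →
          (¬ (w x q ≡ + 0) × ZeroFreeChain q t) ⊎
          (t ⋖ (q ∨ t) × w x q ≡ w t (q ∨ t) × ZeroFreeChain q (q ∨ t))
  slide {x} {q} {t} x⋖q (done x≈t) =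
    inj₂ (⋖-resp x≈t q≈q∨t x⋖q , w-resp x≈t q≈q∨t , done q≈q∨t)
    where
    q≈q∨t : q ≈ (q ∨ t)
    q≈q∨t = antisym (x≤x∨y q t)
      (∨-least ≤-refl (≤-trans (≤-reflexive (≈.sym x≈t)) (⋖⇒≤ x⋖q)))
  slide {x} {q} {t} x⋖q (step {y = s} x⋖s w≢0 c) with upper-covers-≈-dec x⋖q x⋖s
  ... | inj₁ q≈s = inj₁ (w≢0 ∘ trans (w-resp ≈.refl (≈.sym q≈s)) , chain-respˡ (≈.sym q≈s) c)
  ... | inj₂ q≉s = continue (slide (⋖-distinct-∨ x⋖q x⋖s q≉s) c)
    where
    w-q : w x q ≡ w s (q ∨ s)
    w-q = ⋖-distinct-w x⋖q x⋖s q≉s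
    q⋖q∨s : q ⋖ (q ∨ s)
    q⋖q∨s = ⋖-resp ≈.refl (∨-comm s q) (⋖-distinct-∨ x⋖s x⋖q (q≉s ∘ ≈.sym))
    w-s : w x s ≡ w q (q ∨ s)
    w-s = trans (⋖-distinct-w x⋖s x⋖q (q≉s ∘ ≈.sym)) (w-resp ≈.refl (∨-comm s q))
    q∨s∨t : ((q ∨ s) ∨ t) ≈ (q ∨ t)
    q∨s∨t = ≈.trans (∨-assoc q s t) (∨-cong ≈.refl (x≤y⇒x∨y≈y (chain⇒≤ c)))
    continue : (¬ (w s (q ∨ s) ≡ + 0) × ZeroFreeChain (q ∨ s) t) ⊎
               (t ⋖ ((q ∨ s) ∨ t) × w s (q ∨ s) ≡ w t ((q ∨ s) ∨ t) ×
                ZeroFreeChain (q ∨ s) ((q ∨ s) ∨ t)) → _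
    continue (inj₁ (w≢0′ , d)) = inj₁ (w≢0′ ∘ trans (sym w-q) , step q⋖q∨s (w≢0 ∘ trans w-s) d)
    continue (inj₂ (t⋖ , eq , d)) = inj₂
      ( ⋖-resp ≈.refl q∨s∨t t⋖
      , trans w-q (trans eq (w-resp ≈.refl q∨s∨t))
      , step q⋖q∨s (w≢0 ∘ trans w-s) (chain-respʳ q∨s∨t d))

  -- The steps of the first chain are slid along the second one by one. A step absorbed by the
  -- second chain leaves `t` unchanged; any other raises `t` to `q ∨ t` with the same nonzero
  -- weight.
  chain-∨ : ∀ {x y t} → ZeroFreeChain x y → ZeroFreeChain x t → ZeroFreeChain t (y ∨ t)
  chain-∨ (done x≈y) d = done (≈.sym (x≤y⇒x∨y≈y (≤-trans (≤-reflexive (≈.sym x≈y)) (chain⇒≤ d))))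
  chain-∨ {y = y} {t} (step {y = q} x⋖q w≢0 c) d with slide x⋖q d
  ... | inj₁ (_ , e)           = chain-∨ c e
  ... | inj₂ (t⋖q∨t , eq , e) =
    step t⋖q∨t (w≢0 ∘ trans eq) (chain-respʳ y∨q∨t (chain-∨ c e))
    where
    y∨q∨t : (y ∨ (q ∨ t)) ≈ (y ∨ t)
    y∨q∨t = antisym
      (∨-least (x≤x∨y y t) (∨-monotonic (chain⇒≤ c) ≤-refl))
      (∨-monotonic ≤-refl (y≤x∨y q t))

  -- A covering below t cannot slide past t.
  chain-below : ∀ {x q t} → x ⋖ q → q ≤ t → ZeroFreeChain x t →
                ¬ (w x q ≡ + 0) × ZeroFreeChain q t
  chain-below x⋖q q≤t c with slide x⋖q c
  ... | inj₁ result                  = result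
  ... | inj₂ (((_ , t≉q∨t) , _) , _) = contradiction (≈.sym (x≤y⇒x∨y≈y q≤t)) t≉q∨t

-- Descent to the minimum element.

module WithMinimum {a ℓ₁ ℓ₂ : Level} {A : Set a} {_≈_ : Rel A ℓ₁} {_≤_ : Rel A ℓ₂}
                   {r : ℤ} {w : A → A → ℤ} (F : IsFominLattice _≈_ _≤_ r w)
                   (0̂ : A) (0̂-min : Order.Minimum' _≈_ _≤_ 0̂) (r>0 : + 0 < r) where
  open Fomin F public

  ≺-acc : ∀ x → Acc _≺_ x
  ≺-acc x = let xs , all = locallyFinite 0̂ x in
    finite⇒Acc ≈-setoid ≺-trans proj₂ xs (all x (0̂-min x) ≤-refl)
      (λ y (y≤x , _) → all y (0̂-min y) y≤x)

  -- Climbing from `u` inside a finite interval must stop at a lower cover of `x`. The doubly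
  -- negated form avoids deciding whether some element still lies in between.
  below⇒lower-cover : ∀ {u x} → u ≺ x → ¬ (∀ y → ¬ (y ⋖ x))
  below⇒lower-cover {u} {x} u≺x no-cover = go u ≻-acc u≺x
    where
    -- The order is reversed so that the induction climbs, and the bound `y ≤ x` keeps all
    -- predecessors of `u` in the interval from `u` to `x`.
    _⊏_ : Rel A (ℓ₁ ⊔ ℓ₂)
    y ⊏ z = (z ≺ y) × (y ≤ x)
    ≻-acc : Acc _⊏_ u
    ≻-acc = let xs , all = locallyFinite u x in
      finite⇒Acc ≈-setoid
        (λ (z≺y , y≤x) (v≺z , _) → ≺-trans v≺z z≺y , y≤x)
        (λ ((_ , z≉y) , _) → z≉y ∘ ≈.sym)
        xs (all u ≤-refl (proj₁ u≺x)) (λ y ((u≤y , _) , y≤x) → all y u≤y y≤x)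
    go : ∀ v → Acc _⊏_ v → ¬ (v ≺ x)
    go v (acc rs) v≺x = no-cover v (v≺x , λ z v≺z z≺x → go z (rs (v≺z , proj₁ z≺x)) z≺x)

  -- An element without lower covers has an upper cover because r ≢ 0, which
  -- gives access to ⋖-stable.
  minimum-or-cover : ∀ x → (x ≈ 0̂) ⊎ (∃ λ y → y ⋖ x)
  minimum-or-cover x with finiteLowerCovers x | finiteUpperCovers x
  ... | y ∷ _ , _ , lower | _ = inj₂ (y , proj₁ (lower y) (here ≈.refl))
  ... | [] , lo | [] , up =
    contradiction (sym (trans (sym (ℤ.+-identityˡ r)) (differential x [] [] lo up))) (ℤ.<⇒≢ r>0)
  ... | [] , _ , lower | y ∷ _ , _ , upper =
    inj₁ (⋖-stable (proj₁ (upper y) (here ≈.refl)) (0̂-min y) λ x≉0̂ →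
      below⇒lower-cover (0̂-min x , x≉0̂ ∘ ≈.sym) λ z z⋖x → contradiction (proj₂ (lower z) z⋖x) λ ())

  -- Well-founded descent on `y`: a lower cover `u` of `y` already splits the chain, and
  -- `chain-below` shows that `u ⋖ y` has nonzero weight and shifts the upper part to start at `y`.
  chain-split : ∀ {x y} → y ≤ x → ZeroFreeChain 0̂ x → ZeroFreeChain 0̂ y × ZeroFreeChain y x
  chain-split {x} y≤x c = go _ (≺-acc _) y≤x
    where
    go : ∀ y → Acc _≺_ y → y ≤ x → ZeroFreeChain 0̂ y × ZeroFreeChain y x
    go y (acc rs) y≤x with minimum-or-cover y
    ... | inj₁ y≈0̂ = done (≈.sym y≈0̂) , chain-respˡ (≈.sym y≈0̂) c
    ... | inj₂ (u , u⋖y@(u≺y , _)) =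
      let 0̂u , ux  = go u (rs u≺y) (≤-trans (⋖⇒≤ u⋖y) y≤x)
          w≢0 , yx = chain-below u⋖y y≤x ux
      in chain-trans 0̂u (step u⋖y w≢0 (done ≈.refl)) , yx

  -- Meeting with the minimum gives `0̂` and joining with it gives `x`, so membership in the
  -- truncation amounts to a zero-free chain from `0̂`.
  ∼⇒chain : ∀ {x} → x ∼ 0̂ → ZeroFreeChain 0̂ x
  ∼⇒chain {x} c = chain-respʳ (antisym (∨-least ≤-refl (0̂-min x)) (x≤x∨y x 0̂))
    (chain-respˡ (y≤x⇒x∧y≈y (0̂-min x)) c)

  chain⇒∼ : ∀ {x} → ZeroFreeChain 0̂ x → x ∼ 0̂
  chain⇒∼ {x} c = chain-respʳ (antisym (x≤x∨y x 0̂) (∨-least ≤-refl (0̂-min x)))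
    (chain-respˡ (≈.sym (y≤x⇒x∧y≈y (0̂-min x))) c)

  -- Closure properties of the truncation.

  ∼-down : ∀ {x y} → y ≤ x → x ∼ 0̂ → y ∼ 0̂
  ∼-down y≤x = chain⇒∼ ∘ proj₁ ∘ chain-split y≤x ∘ ∼⇒chain

  ∼-∨ : ∀ {x y} → x ∼ 0̂ → y ∼ 0̂ → (x ∨ y) ∼ 0̂
  ∼-∨ x∼0̂ y∼0̂ = chain⇒∼ (chain-trans (∼⇒chain y∼0̂) (chain-∨ (∼⇒chain x∼0̂) (∼⇒chain y∼0̂)))

  ∼-⋖ : ∀ {x y} → x ⋖ y → ¬ (w x y ≡ + 0) → x ∼ 0̂ → y ∼ 0̂
  ∼-⋖ x⋖y w≢0 x∼0̂ = chain⇒∼ (chain-trans (∼⇒chain x∼0̂) (step x⋖y w≢0 (done ≈.refl)))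

  ∼⇒w≢0 : ∀ {x y t} → x ⋖ y → y ≤ t → t ∼ 0̂ → ¬ (w x y ≡ + 0)
  ∼⇒w≢0 x⋖y y≤t t∼0̂ = proj₁ (chain-below x⋖y y≤t
    (proj₂ (chain-split (≤-trans (⋖⇒≤ x⋖y) y≤t) (∼⇒chain t∼0̂))))

  -- Coverings and cover lists in the truncation.

  L/ : Set (a ⊔ ℓ₁ ⊔ ℓ₂)
  L/ = Carrier/ 0̂

  open Order {A = L/} _≈/_ _≤/_ public using () renaming
    ( _⋖_ to _⋖/_; _∈≈_ to _∈≈/_
    ; IsUpperCoverList to IsUpperCoverList/; IsLowerCoverList to IsLowerCoverList/)

  -- By downward closure, anything strictly between `x` and `y` would itself belong to the
  -- truncation.
  ⋖/⇒⋖ : ∀ (x y : L/) → x ⋖/ y → proj₁ x ⋖ proj₁ y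
  ⋖/⇒⋖ _ (_ , y∼0̂) (x≺y , empty) =
    x≺y , λ z x≺z z≺y → empty (z , ∼-down (proj₁ z≺y) y∼0̂) x≺z z≺y

  ⋖⇒⋖/ : ∀ (x y : L/) → proj₁ x ⋖ proj₁ y → x ⋖/ y
  ⋖⇒⋖/ _ _ (x≺y , empty) = x≺y , λ (z , _) → empty z

  ≈/-setoid : Setoid (a ⊔ ℓ₁ ⊔ ℓ₂) ℓ₁
  ≈/-setoid = On.setoid {B = L/} ≈-setoid proj₁

  -- Downward closure keeps every lower cover, so the lower sum in the differential identity does
  -- not change.
  lowerCovers/⇒lowerCovers : ∀ (x : L/) (ys : List L/) →
    IsLowerCoverList/ x ys → IsLowerCoverList (proj₁ x) (map proj₁ ys)
  lowerCovers/⇒lowerCovers x/@(x , x∼0̂) ys (distinct , covers) =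
    AllPairs.map⁺ distinct , λ y →
      (λ y∈ys → All.lookupWith (λ u⋖x y≈u → ⋖-resp (≈.sym y≈u) ≈.refl u⋖x) ys⋖x (Any.map⁻ y∈ys)) ,
      (λ y⋖x → let y/ = y , ∼-down (⋖⇒≤ y⋖x) x∼0̂ in
        Any.map⁺ (proj₂ (covers y/) (⋖⇒⋖/ y/ x/ y⋖x)))
    where
    ys⋖x : All (λ y → proj₁ y ⋖ x) ys
    ys⋖x = All-members ≈/-setoid ys (λ y → ⋖/⇒⋖ y x/ ∘ proj₁ (covers y))

  lowerCovers/ : ∀ (x : L/) → ∃ λ ys → IsLowerCoverList/ x ys
  lowerCovers/ x/@(x , x∼0̂) with finiteLowerCovers x
  ... | ys , distinct , covers
    with lift-list (All-members ≈-setoid ys λ y y∈ys → ∼-down (⋖⇒≤ (proj₁ (covers y) y∈ys)) x∼0̂)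
  ... | ys/ , refl = ys/ , AllPairs.map⁻ distinct , λ y/@(y , _) →
    ⋖⇒⋖/ y/ x/ ∘ proj₁ (covers y) ∘ Any.map⁺ , Any.map⁻ ∘ proj₂ (covers y) ∘ ⋖/⇒⋖ y/ x/

  -- An upper cover of `x` stays in the truncation exactly when its weight is nonzero, by `∼-⋖` and
  -- `∼⇒w≢0`; hence the filter.
  upperCovers/ : ∀ (x : L/) → ∃ λ zs → IsUpperCoverList/ x zs
  upperCovers/ x/@(x , x∼0̂) =
    zs/ , AllPairs.map⁻ distinct/ , λ z/@(z , z∼0̂) →
      (λ z∈ → ⋖⇒⋖/ x/ z/ (proj₁ (members z (subst (z ∈≈_) zs/-eq (Any.map⁺ z∈))))) ,
      (λ x⋖/z → let x⋖z = ⋖/⇒⋖ x/ z/ x⋖/z in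
        Any.map⁻ (subst (z ∈≈_) (sym zs/-eq)
          (Membership.∈-filter⁺ ≈-setoid nonzero? nonzero-resp (proj₂ (covers z) x⋖z)
            (∼⇒w≢0 x⋖z ≤-refl z∼0̂))))
    where
    zs = proj₁ (finiteUpperCovers x)
    covers = proj₂ (proj₂ (finiteUpperCovers x))
    nonzero? = λ z → ¬? (w x z ≟ + 0)
    nonzero-resp : ∀ {z z′} → z ≈ z′ → ¬ (w x z ≡ + 0) → ¬ (w x z′ ≡ + 0)
    nonzero-resp z≈z′ w≢0 = w≢0 ∘ trans (w-resp ≈.refl z≈z′)
    members : ∀ z → z ∈≈ filter nonzero? zs → x ⋖ z × ¬ (w x z ≡ + 0)
    members z z∈ = let z∈zs , w≢0 = Membership.∈-filter⁻ ≈-setoid nonzero? nonzero-resp z∈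
                   in proj₁ (covers z) z∈zs , w≢0
    lifted = lift-list (All-members ≈-setoid (filter nonzero? zs) λ z z∈ →
               let x⋖z , w≢0 = members z z∈ in ∼-⋖ x⋖z w≢0 x∼0̂)
    zs/ = proj₁ lifted
    zs/-eq = proj₂ lifted
    distinct/ : AllPairs (λ u v → ¬ (u ≈ v)) (map proj₁ zs/)
    distinct/ = subst (AllPairs _) (sym zs/-eq)
      (AllPairs.filter⁺ nonzero? (proj₁ (proj₂ (finiteUpperCovers x))))

  -- The given list `zs` is arbitrary, so the ambient identity is applied to `zs` extended by the
  -- weight-zero covers `us`, whose contribution vanishes.
  differential/ : ∀ (x : L/) (ys zs : List L/) → IsLowerCoverList/ x ys → IsUpperCoverList/ x zs →
    sumℤ (map (λ y → w/ y x) ys) + r ≡ sumℤ (map (λ z → w/ x z) zs)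
  differential/ x/@(x , x∼0̂) ys zs lower (distinct , covers) = begin
    sumℤ (map (λ y → w/ y x/) ys) + r
      ≡⟨ cong (λ s → sumℤ s + r) (map-∘ ys) ⟩
    sumℤ (map (λ y → w y x) (map proj₁ ys)) + r
      ≡⟨ differential x (map proj₁ ys) (map proj₁ zs ++ us)
           (lowerCovers/⇒lowerCovers x/ ys lower) all-covers ⟩
    sumℤ (map (w x) (map proj₁ zs ++ us))
      ≡⟨ cong sumℤ (map-++ (w x) (map proj₁ zs) us) ⟩
    sumℤ (map (w x) (map proj₁ zs) ++ map (w x) us)
      ≡⟨ sumℤ-++ (map (w x) (map proj₁ zs)) (map (w x) us) ⟩
    sumℤ (map (w x) (map proj₁ zs)) + sumℤ (map (w x) us)
      ≡⟨ cong₂ _+_ (cong sumℤ (sym (map-∘ zs))) (sumℤ-zeros us-zero) ⟩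
    sumℤ (map (λ z → w/ x/ z) zs) + + 0
      ≡⟨ ℤ.+-identityʳ _ ⟩
    sumℤ (map (λ z → w/ x/ z) zs) ∎
    where
    open ≡-Reasoning
    zero? = λ z → w x z ≟ + 0
    zero-resp : ∀ {z z′} → z ≈ z′ → w x z ≡ + 0 → w x z′ ≡ + 0
    zero-resp z≈z′ = trans (sym (w-resp ≈.refl z≈z′))
    all-upper = finiteUpperCovers x
    us = filter zero? (proj₁ all-upper)
    us-zero : All (λ u → w x u ≡ + 0) us
    us-zero = All.all-filter zero? (proj₁ all-upper)
    zs⋖ : All (λ z → x ⋖ proj₁ z) zs
    zs⋖ = All-members ≈/-setoid zs (λ z → ⋖/⇒⋖ x/ z ∘ proj₁ (covers z))
    all-covers : IsUpperCoverList x (map proj₁ zs ++ us)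
    all-covers =
      AllPairs.++⁺ (AllPairs.map⁺ distinct) (AllPairs.filter⁺ zero? (proj₁ (proj₂ all-upper)))
        -- No entry of `zs` equals an entry of `us`: the former have nonzero weight, the latter
        -- weight zero.
        (All.map⁺ (All.map
          (λ {z} x⋖z → All.map (λ w≡0 z≈u →
            ∼⇒w≢0 x⋖z ≤-refl (proj₂ z) (trans (w-resp ≈.refl z≈u) w≡0)) us-zero)
          zs⋖)) ,
      λ y → from y , to y
      where
      from : ∀ y → y ∈≈ (map proj₁ zs ++ us) → x ⋖ y
      from y y∈ with Any.++⁻ (map proj₁ zs) y∈
      ... | inj₁ y∈zs = All.lookupWith (λ x⋖z y≈z → ⋖-resp ≈.refl (≈.sym y≈z) x⋖z) zs⋖ (Any.map⁻ y∈zs)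
      ... | inj₂ y∈us = proj₁ (proj₂ (proj₂ all-upper) y)
        (proj₁ (Membership.∈-filter⁻ ≈-setoid zero? zero-resp y∈us))
      to : ∀ y → x ⋖ y → y ∈≈ (map proj₁ zs ++ us)
      to y x⋖y with zero? y
      ... | yes w≡0 = Any.++⁺ʳ (map proj₁ zs)
        (Membership.∈-filter⁺ ≈-setoid zero? zero-resp (proj₂ (proj₂ (proj₂ all-upper) y) x⋖y) w≡0)
      ... | no w≢0 = let y/ = y , ∼-⋖ x⋖y w≢0 x∼0̂ in
        Any.++⁺ˡ (Any.map⁺ (proj₂ (covers y/) (⋖⇒⋖/ x/ y/ x⋖y)))

  -- The truncation as a Fomin lattice.

  truncation-isFominLattice : IsFominLattice {A = L/} _≈/_ _≤/_ r w/
  truncation-isFominLattice = record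
    { _∨_ = λ (x , x∼0̂) (y , y∼0̂) → (x ∨ y) , ∼-∨ x∼0̂ y∼0̂
    ; _∧_ = λ (x , x∼0̂) (y , _) → (x ∧ y) , ∼-down (x∧y≤x x y) x∼0̂
    ; isLattice = record
      { isPartialOrder = On.isPartialOrder proj₁ isPartialOrder
      ; supremum = λ (x , _) (y , _) → x≤x∨y x y , y≤x∨y x y , λ _ → ∨-least
      ; infimum = λ (x , _) (y , _) → x∧y≤x x y , x∧y≤y x y , λ _ → ∧-greatest
      }
    ; modular = λ (x , _) (y , _) (z , _) → modular x y z
    -- Truncating a listed element by ∧ y puts it into L/ and fixes those below y.
    ; locallyFinite = λ (x , _) (y , y∼0̂) →
        let zs , all = locallyFinite x y
        in map (λ z → (z ∧ y) , ∼-down (x∧y≤y z y) y∼0̂) zs , λ (z , _) x≤z z≤y →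
          Any.map⁺ (Any.map
            (λ z≈u → ≈.trans (≈.sym (≈.trans (∧-comm z y) (y≤x⇒x∧y≈y z≤y))) (∧-cong z≈u ≈.refl))
            (all z x≤z z≤y))
    ; finiteUpperCovers = upperCovers/
    ; finiteLowerCovers = lowerCovers/
    ; w-resp = w-resp
    ; differential = differential/
    ; projective = λ x/@(x , x∼0̂) y/@(y , y∼0̂) x⋖ y⋖ ⋖x ⋖y →
        let j/ = (x ∨ y) , ∼-∨ x∼0̂ y∼0̂
            m/ = (x ∧ y) , ∼-down (x∧y≤x x y) x∼0̂
        in projective x y (⋖/⇒⋖ x/ j/ x⋖) (⋖/⇒⋖ y/ j/ y⋖) (⋖/⇒⋖ m/ x/ ⋖x) (⋖/⇒⋖ m/ y/ ⋖y)
    }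

theorem4p18 : ∀ {a ℓ₁ ℓ₂ : Level} {A : Set a} {_≈_ : Rel A ℓ₁} {_≤_ : Rel A ℓ₂}
    {r : ℤ} {w : A → A → ℤ} (F : IsFominLattice _≈_ _≤_ r w) (0̂ : A) →
    Order.Minimum' _≈_ _≤_ 0̂ →
    + 0 < r →
    (∀ x y → Order._⋖_ _≈_ _≤_ x y → w x y < + 0 →
    ∃ λ z → ∃ λ v → Order._⋖_ _≈_ _≤_ z v × (v ≤ x) × (w z v ≡ + 0)) →
    Σ (IsFominLattice (Truncation._≈/_ F {0̂}) (Truncation._≤/_ F {0̂}) r (Truncation.w/ F {0̂}))
    (λ _ → (∃ λ (m : Truncation.Carrier/ F 0̂) →
    (proj₁ m ≈ 0̂) × Order.Minimum' (Truncation._≈/_ F {0̂}) (Truncation._≤/_ F {0̂}) m)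
    × IsPositive (Truncation._≈/_ F {0̂}) (Truncation._≤/_ F {0̂}) r (Truncation.w/ F {0̂}))
theorem4p18 {w = w} F 0̂ 0̂-min r>0 negative⇒zero-below =
  truncation-isFominLattice ,
  ((0̂ , chain⇒∼ (done ≈.refl)) , ≈.refl , λ (x , _) → 0̂-min x) ,
  r>0 , positive
  where
  open WithMinimum F 0̂ 0̂-min r>0
  positive : ∀ (x y : L/) → x ⋖/ y → + 0 < w (proj₁ x) (proj₁ y)
  positive x/@(x , x∼0̂) y/@(y , y∼0̂) x⋖/y with ℤ.<-cmp (+ 0) (w x y)
  ... | tri< w>0 _ _ = w>0
  ... | tri≈ _ w≡0 _ = contradiction (sym w≡0) (∼⇒w≢0 (⋖/⇒⋖ x/ y/ x⋖/y) ≤-refl y∼0̂)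
  -- A negative weight would force a weight-zero covering below `x`, which membership of `x` in the
  -- truncation excludes.
  ... | tri> _ _ w<0 =
    let z , v , z⋖v , v≤x , w≡0 = negative⇒zero-below x y (⋖/⇒⋖ x/ y/ x⋖/y) w<0
    in contradiction w≡0 (∼⇒w≢0 z⋖v v≤x x∼0̂)
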